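{- (1) Let $(A,\wedge,\vee,\top,\mathsf p,\mathsf q)$ be a $d\ell\mathsf{pq}$-algebra and define $x\cdot y=(\mathsf p x\wedge y)\vee(x\wedge \mathsf q y)$ for $x,y\in A$. Then $(A,\wedge,\vee,\top,\cdot)$ is a unary-determined $d\ell$-magma, and $\mathsf p,\mathsf q$ are given by $\mathsf p x=x\cdot\top$ and $\mathsf q x=\top\cdot x$ for all $x\in A$. (2) Let $(A,\wedge,\vee,\top,\cdot)$ be a unary-determined $d\ell$-magma and define $\mathsf p x=x\cdot\top$ and $\mathsf q x=\top\cdot x$ for $x\in A$. Then $(A,\wedge,\vee,\top,\mathsf p,\mathsf q)$ is a $d\ell\mathsf{pq}$-algebra, and $\cdot$ is definable from $\mathsf p,\mathsf q$ via $x\cdot y=(\mathsf p x\wedge y)\vee(x\wedge\mathsf q y)$ for all $x,y\in A$.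
   Context: A $d\ell$-magma is an algebra $(A,\wedge,\vee,\cdot)$ where $(A,\wedge,\vee)$ is a distributive lattice and $\cdot$ is a binary operation satisfying $x\cdot(y\vee z)=x\cdot y\vee x\cdot z$ and $(x\vee y)\cdot z=x\cdot z\vee y\cdot z$. It is $\top$-bounded if the lattice has a top element $\top$. A $d\ell$-magma is unary-determined if it is $\top$-bounded and satisfies the identity $x\cdot y=((x\cdot\top)\wedge y)\vee(x\wedge(\top\cdot y))$. A unary operator on a lattice is a unary operation $f$ with $f(x\vee y)=fx\vee fy$ for all $x,y$. A $d\ell\mathsf{pq}$-algebra is a distributive lattice with top element $\top$ and two unary operators $\mathsf p,\mathsf q$ satisfying, for all $x$, $x\wedge\mathsf p\top\le\mathsf q x$ and $x\wedge\mathsf q\top\le\mathsf p x$. -}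

module Defs where

open import Algebra.Core using (Op₁; Op₂)
import Algebra.Definitions as AlgDefs
open import Algebra.Lattice.Structures using (IsDistributiveLattice)
open import Level using (_⊔_)
open import Relation.Binary.Core using (Rel)
open import Relation.Binary.Definitions using (Maximum)
import Relation.Binary.Construct.NaturalOrder.Left as NaturalOrder

-- Equality is an arbitrary equivalence relation _≈_, as in the standard
-- library's algebraic hierarchy, so every operation carries a congruence law.
-- The lattice order is the library's natural order of the meet operation:
-- x ≤ y unfolds to x ≈ (x ∧ y).

module _ {a ℓ} {A : Set a} (_≈_ : Rel A ℓ) where

  open AlgDefs _≈_ using (Congruent₁; Congruent₂; _DistributesOver_)

  IsTop : (_∧_ : Op₂ A) (⊤ : A) → Set (a ⊔ ℓ)
  IsTop _∧_ ⊤ = Maximum _≤_ ⊤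
    where open NaturalOrder _≈_ _∧_ using (_≤_)

  record IsDℓMagma (_∨_ _∧_ _·_ : Op₂ A) : Set (a ⊔ ℓ) where
    field
      isDistributiveLattice : IsDistributiveLattice _≈_ _∨_ _∧_
      ·-cong                : Congruent₂ _·_
      ·-distrib-∨           : _·_ DistributesOver _∨_

  record IsUnaryDetermined (_∨_ _∧_ : Op₂ A) (⊤ : A) (_·_ : Op₂ A)
                           : Set (a ⊔ ℓ) where
    field
      isDℓMagma       : IsDℓMagma _∨_ _∧_ _·_
      isTop           : IsTop _∧_ ⊤
      unaryDetermined : ∀ x y →
                        (x · y) ≈ (((x · ⊤) ∧ y) ∨ (x ∧ (⊤ · y)))

  record IsUnaryOperator (_∨_ : Op₂ A) (f : Op₁ A) : Set (a ⊔ ℓ) where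
    field
      cong   : Congruent₁ f
      ∨-homo   : ∀ x y → f (x ∨ y) ≈ (f x ∨ f y)

  record IsDℓpqAlgebra (_∨_ _∧_ : Op₂ A) (⊤ : A) (p q : Op₁ A)
                       : Set (a ⊔ ℓ) where
    open NaturalOrder _≈_ _∧_ using (_≤_)
    field
      isDistributiveLattice : IsDistributiveLattice _≈_ _∨_ _∧_
      isTop                 : IsTop _∧_ ⊤
      p-isUnaryOperator     : IsUnaryOperator _∨_ p
      q-isUnaryOperator     : IsUnaryOperator _∨_ q
      x∧p⊤≤qx               : ∀ x → (x ∧ p ⊤) ≤ q x
      x∧q⊤≤px               : ∀ x → (x ∧ q ⊤) ≤ p x

{-# OPTIONS --safe #-}
module Submission where

open import Defs
open import Algebra.Core using (Op₁; Op₂)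
open import Algebra.Bundles using (CommutativeSemigroup)
open import Algebra.Lattice.Bundles using (DistributiveLattice)
open import Algebra.Lattice.Structures using (IsDistributiveLattice)
import Algebra.Lattice.Properties.DistributiveLattice as DistributiveLatticeProperties
import Algebra.Properties.CommutativeSemigroup as CommutativeSemigroupProperties
open import Algebra.Structures using (IsCommutativeBand)
open import Data.Product using (_×_; _,_; proj₁; proj₂)
open import Relation.Binary.Core using (Rel)
import Relation.Binary.Lattice as OrderTheoretic
import Relation.Binary.Lattice.Properties.JoinSemilattice as JoinSemilatticeProperties
import Relation.Binary.Reasoning.Setoid as SetoidReasoning

-- The two inequalities of a dℓpq-algebra are absorption conditions. Setting one argument of
-- `(p x ∧ y) ∨ (x ∧ q y)` to `⊤` leaves the wanted value joined with one extra term, `x ∧ q ⊤` or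
-- `p ⊤ ∧ x`, and the inequalities say exactly that this term is absorbed. So `p` and `q` are
-- recovered from the product (`p≈·⊤`, `q≈⊤·`), and substituting them back into its definition gives
-- the unary-determined identity. Conversely, both `p ⊤` and `q ⊤` are `⊤ · ⊤`, and the identity
-- with one argument `⊤` exhibits `x ∧ (⊤ · ⊤)` as a joinand of `⊤ · x` and of `x · ⊤`. The formula
-- for the product is then the identity itself.

module TopBounded {a ℓ} {A : Set a} {_≈_ : Rel A ℓ} {_∨_ _∧_ : Op₂ A} {⊤ : A}
  (isDL : IsDistributiveLattice _≈_ _∨_ _∧_) (isTop : IsTop _≈_ _∧_ ⊤) where

  distributiveLattice : DistributiveLattice a ℓ
  distributiveLattice = record { isDistributiveLattice = isDL }

  open DistributiveLattice distributiveLattice public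
    using ( setoid; refl; sym; trans; ∧-comm; ∨-comm; ∧-cong; ∧-congˡ; ∧-congʳ
          ; ∨-cong; ∨-congˡ; ∨-congʳ; ∧-distribˡ-∨; ∧-distribʳ-∨)
  open DistributiveLatticeProperties distributiveLattice
    using (∨-isSemilattice; ∨-∧-orderTheoreticLattice)
  -- This order also unfolds to `x ≈ (x ∧ y)`, so the inequalities of the structures can be used
  -- with its lemmas without conversion.
  open OrderTheoretic.Lattice ∨-∧-orderTheoreticLattice public
    using (_≤_; x≤x∨y; y≤x∨y; ≤-respˡ-≈; ≤-respʳ-≈)
  open OrderTheoretic.Lattice ∨-∧-orderTheoreticLattice using (joinSemilattice)
  open JoinSemilatticeProperties joinSemilattice public using (x≤y⇒x∨y≈y)

  ∨-commutativeSemigroup : CommutativeSemigroup a ℓ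
  ∨-commutativeSemigroup = record
    { isCommutativeSemigroup = IsCommutativeBand.isCommutativeSemigroup ∨-isSemilattice }

  open CommutativeSemigroupProperties ∨-commutativeSemigroup public
    using () renaming (interchange to ∨-interchange)

  ∧-identityˡ : ∀ x → (⊤ ∧ x) ≈ x
  ∧-identityˡ x = trans (∧-comm ⊤ x) (sym (isTop x))

module FromUnaryOperators {a ℓ} {A : Set a} {_≈_ : Rel A ℓ} {_∨_ _∧_ : Op₂ A} {⊤ : A}
  {p q : Op₁ A} (isDℓpq : IsDℓpqAlgebra _≈_ _∨_ _∧_ ⊤ p q) where

  open IsDℓpqAlgebra isDℓpq
  open TopBounded isDistributiveLattice isTop
  open SetoidReasoning setoid
  open IsUnaryOperator p-isUnaryOperator using () renaming (cong to p-cong; ∨-homo to p-∨-homo)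
  open IsUnaryOperator q-isUnaryOperator using () renaming (cong to q-cong; ∨-homo to q-∨-homo)

  _·_ : Op₂ A
  x · y = (p x ∧ y) ∨ (x ∧ q y)

  p≈·⊤ : ∀ x → p x ≈ (x · ⊤)
  p≈·⊤ x = begin
    p x                      ≈⟨ x≤y⇒x∨y≈y (x∧q⊤≤px x) ⟨
    (x ∧ q ⊤) ∨ p x          ≈⟨ ∨-comm _ _ ⟩
    p x ∨ (x ∧ q ⊤)          ≈⟨ ∨-congʳ (isTop (p x)) ⟩
    (p x ∧ ⊤) ∨ (x ∧ q ⊤)    ∎

  q≈⊤· : ∀ x → q x ≈ (⊤ · x)
  q≈⊤· x = begin
    q x                      ≈⟨ x≤y⇒x∨y≈y (x∧p⊤≤qx x) ⟨
    (x ∧ p ⊤) ∨ q x          ≈⟨ ∨-cong (∧-comm _ _) (sym (∧-identityˡ (q x))) ⟩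
    (p ⊤ ∧ x) ∨ (⊤ ∧ q x)    ∎

  -- Only `q` acts on the second argument and it preserves joins, so lattice distributivity yields
  -- four joinands, which `∨-interchange` regroups by `y` and `z`.
  ·-distribˡ-∨ : ∀ x y z → (x · (y ∨ z)) ≈ ((x · y) ∨ (x · z))
  ·-distribˡ-∨ x y z = begin
    (p x ∧ (y ∨ z)) ∨ (x ∧ q (y ∨ z))
      ≈⟨ ∨-congˡ (∧-congˡ (q-∨-homo y z)) ⟩
    (p x ∧ (y ∨ z)) ∨ (x ∧ (q y ∨ q z))
      ≈⟨ ∨-cong (∧-distribˡ-∨ _ _ _) (∧-distribˡ-∨ _ _ _) ⟩
    ((p x ∧ y) ∨ (p x ∧ z)) ∨ ((x ∧ q y) ∨ (x ∧ q z))
      ≈⟨ ∨-interchange _ _ _ _ ⟩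
    (x · y) ∨ (x · z) ∎

  ·-distribʳ-∨ : ∀ x y z → ((y ∨ z) · x) ≈ ((y · x) ∨ (z · x))
  ·-distribʳ-∨ x y z = begin
    (p (y ∨ z) ∧ x) ∨ ((y ∨ z) ∧ q x)
      ≈⟨ ∨-congʳ (∧-congʳ (p-∨-homo y z)) ⟩
    ((p y ∨ p z) ∧ x) ∨ ((y ∨ z) ∧ q x)
      ≈⟨ ∨-cong (∧-distribʳ-∨ _ _ _) (∧-distribʳ-∨ _ _ _) ⟩
    ((p y ∧ x) ∨ (p z ∧ x)) ∨ ((y ∧ q x) ∨ (z ∧ q x))
      ≈⟨ ∨-interchange _ _ _ _ ⟩
    (y · x) ∨ (z · x) ∎

  isUnaryDetermined : IsUnaryDetermined _≈_ _∨_ _∧_ ⊤ _·_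
  isUnaryDetermined = record
    { isDℓMagma = record
      { isDistributiveLattice = isDistributiveLattice
      ; ·-cong      = λ x≈x′ y≈y′ → ∨-cong (∧-cong (p-cong x≈x′) y≈y′) (∧-cong x≈x′ (q-cong y≈y′))
      ; ·-distrib-∨ = ·-distribˡ-∨ , ·-distribʳ-∨
      }
    ; isTop           = isTop
    ; unaryDetermined = λ x y → ∨-cong (∧-congʳ (p≈·⊤ x)) (∧-congˡ (q≈⊤· y))
    }

module FromUnaryDetermined {a ℓ} {A : Set a} {_≈_ : Rel A ℓ} {_∨_ _∧_ : Op₂ A} {⊤ : A}
  {_·_ : Op₂ A} (isUD : IsUnaryDetermined _≈_ _∨_ _∧_ ⊤ _·_) where

  open IsUnaryDetermined isUD
  open IsDℓMagma isDℓMagma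
  open TopBounded isDistributiveLattice isTop

  -- Up to commutativity, the left side is the first joinand of the identity at `⊤`, `x`; in the
  -- next lemma it is the second joinand at `x`, `⊤`.
  x∧⊤⊤≤⊤x : ∀ x → (x ∧ (⊤ · ⊤)) ≤ (⊤ · x)
  x∧⊤⊤≤⊤x x = ≤-respˡ-≈ (∧-comm _ _) (≤-respʳ-≈ (sym (unaryDetermined ⊤ x)) (x≤x∨y _ _))

  x∧⊤⊤≤x⊤ : ∀ x → (x ∧ (⊤ · ⊤)) ≤ (x · ⊤)
  x∧⊤⊤≤x⊤ x = ≤-respʳ-≈ (sym (unaryDetermined x ⊤)) (y≤x∨y _ _)

  isDℓpqAlgebra : IsDℓpqAlgebra _≈_ _∨_ _∧_ ⊤ (_· ⊤) (⊤ ·_)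
  isDℓpqAlgebra = record
    { isDistributiveLattice = isDistributiveLattice
    ; isTop             = isTop
    ; p-isUnaryOperator = record
      -- Preservation of joins by `p` is right distributivity with the right factor fixed at `⊤`;
      -- for `q` it is left distributivity.
      { cong = λ x≈y → ·-cong x≈y refl ; ∨-homo = proj₂ ·-distrib-∨ ⊤ }
    ; q-isUnaryOperator = record
      { cong = ·-cong refl ; ∨-homo = proj₁ ·-distrib-∨ ⊤ }
    ; x∧p⊤≤qx = x∧⊤⊤≤⊤x
    ; x∧q⊤≤px = x∧⊤⊤≤x⊤
    }

theorem2p1 : ∀ {a ℓ} {A : Set a} (_≈_ : Rel A ℓ) (_∨_ _∧_ : Op₂ A) (⊤ : A) →
  ((p q : Op₁ A) → IsDℓpqAlgebra _≈_ _∨_ _∧_ ⊤ p q →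
    let _·_ : Op₂ A
        _·_ = λ x y → (p x ∧ y) ∨ (x ∧ q y)
    in IsUnaryDetermined _≈_ _∨_ _∧_ ⊤ _·_
       × (∀ x → p x ≈ (x · ⊤))
       × (∀ x → q x ≈ (⊤ · x)))
  ×
  ((_·_ : Op₂ A) → IsUnaryDetermined _≈_ _∨_ _∧_ ⊤ _·_ →
    let p : Op₁ A
        p = λ x → x · ⊤
        q : Op₁ A
        q = λ x → ⊤ · x
    in IsDℓpqAlgebra _≈_ _∨_ _∧_ ⊤ p q
       × (∀ x y → (x · y) ≈ ((p x ∧ y) ∨ (x ∧ q y))))
theorem2p1 _≈_ _∨_ _∧_ ⊤ =
    (λ p q isDℓpq → let open FromUnaryOperators isDℓpq in isUnaryDetermined , p≈·⊤ , q≈⊤·)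
  , (λ _·_ isUD → FromUnaryDetermined.isDℓpqAlgebra isUD , IsUnaryDetermined.unaryDetermined isUD)
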